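{- For every formula $A$ of $\mathbf{L_1}$, if not $\vdash_H A$, then $\dashv_H A$. That is, every formula satisfies $\vdash_H A$ or $\dashv_H A$.
   Context: Formulas of $\mathbf{L_1}$: built from atomic formulas $\epsilon ab$ ($a,b$ name variables, possibly equal) with primitive connectives $\vee,\sim$; $\wedge,\supset,\equiv$ defined as usual. Disjunctions may be associated in any way. $\vdash_H A$: $A$ belongs to the smallest set containing all instances of classical propositional tautologies and all formulas $\epsilon ab\supset\epsilon aa$, $(\epsilon ab\wedge\epsilon bc)\supset\epsilon ac$, $(\epsilon ab\wedge\epsilon bb)\supset\epsilon ba$, closed under modus ponens. Positive/negative parts (occurrences): $A$ is a positive part of $A$; if $B\vee C$ is a positive part then $B,C$ are positive parts; if $\sim B$ is a positive part then $B$ is a negative part; if $\sim B$ is a negative part then $B$ is a positive part. $F[B_+,B_-]$ denotes a formula in which some formula $B$ has one occurrence as positive part and another non-overlapping occurrence as negative part. Hintikka formula: a formula $H$ such that (1) $H$ is not of the form $F[B_+,B_-]$; (2) if $B\vee C$ is a negative part of $H$ then $B$ or $C$ is; (3) if $\epsilon ab$ is a negative part then so is $\epsilon aa$; (4) if $\epsilon ab,\epsilon bc$ are negative parts then so is $\epsilon ac$; (5) if $\epsilon ab,\epsilon bb$ are negative parts then so is $\epsilon ba$. $\mathbf{HAR}$: fix a name variable $a_0$; $\dashv_H$ is the smallest set such that $\dashv_H\epsilon a_0a_0$; $\dashv_H\sim\epsilon a_0a_0$; if $\vdash_H A\supset B$ and $\dashv_H B$ then $\dashv_H A$; if $\dashv_H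 A$ and $A$ is obtained from $B$ by uniform substitution of name variables for name variables then $\dashv_H B$; if $A$ is a Hintikka formula that is a disjunction of atomic or negated atomic formulas, $\dashv_H A$, and $\epsilon ab$ is not a negative part of $A$, then $\dashv_H A\vee\epsilon ab$. -}

module Defs where

open import Data.Bool.Base using (Bool; true; not) renaming (_∨_ to _or_)
open import Data.Nat.Base using (ℕ)
open import Data.Product.Base using (_×_; _,_; Σ-syntax; ∃-syntax)
open import Data.Sum.Base using (_⊎_)
open import Relation.Binary.PropositionalEquality.Core using (_≡_)
open import Relation.Nullary.Negation.Core using (¬_)

infix  9 ~_
infixr 8 _∧_
infixr 7 _∨_
infixr 6 _⊃_
infix  5 _≣_
infix  4 ⊢H_ _⊣H_ _⊑_

-- Propositional formulas over a type of atoms.  `Form ℕ` serves as the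
-- language of propositional schemata, `Form (Name × Name)` as L₁.

data Form (X : Set) : Set where
  atom : X → Form X
  ~_   : Form X → Form X
  _∨_  : Form X → Form X → Form X

_∧_ _⊃_ _≣_ : ∀ {X} → Form X → Form X → Form X
A ∧ B = ~ (~ A ∨ ~ B)
A ⊃ B = ~ A ∨ B
A ≣ B = (A ⊃ B) ∧ (B ⊃ A)

_⟪_⟫ : ∀ {X Y} → Form X → (X → Form Y) → Form Y
atom x  ⟪ σ ⟫ = σ x
(~ A)   ⟪ σ ⟫ = ~ (A ⟪ σ ⟫)
(A ∨ B) ⟪ σ ⟫ = (A ⟪ σ ⟫) ∨ (B ⟪ σ ⟫)

eval : ∀ {X} → (X → Bool) → Form X → Bool
eval v (atom x) = v x
eval v (~ A)    = not (eval v A)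
eval v (A ∨ B)  = eval v A or eval v B

Tautology : ∀ {X} → Form X → Set
Tautology {X} P = (v : X → Bool) → eval v P ≡ true

Name : Set
Name = ℕ

Formula : Set
Formula = Form (Name × Name)

pattern ε a b = atom (a , b)

rename : (Name → Name) → Formula → Formula
rename σ A = A ⟪ (λ (a , b) → ε (σ a) (σ b)) ⟫

data ⊢H_ : Formula → Set where
  taut : (P : Form ℕ) → Tautology P → (σ : ℕ → Formula) → ⊢H P ⟪ σ ⟫
  ax₁  : ∀ a b → ⊢H ε a b ⊃ ε a a
  ax₂  : ∀ a b c → ⊢H (ε a b ∧ ε b c) ⊃ ε a c
  ax₃  : ∀ a b → ⊢H (ε a b ∧ ε b b) ⊃ ε b a
  mp   : ∀ {A B} → ⊢H A ⊃ B → ⊢H A → ⊢H B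

data Sign : Set where
  pos neg : Sign

-- An element of `Part F s B` is an occurrence of B in F as a part of sign s:
-- its constructors spell out the path from the root of F to the occurrence.

data Part (F : Formula) : Sign → Formula → Set where
  whole : Part F pos F
  ∨ˡ    : ∀ {B C} → Part F pos (B ∨ C) → Part F pos B
  ∨ʳ    : ∀ {B C} → Part F pos (B ∨ C) → Part F pos C
  ~⁺    : ∀ {B} → Part F pos (~ B) → Part F neg B
  ~⁻    : ∀ {B} → Part F neg (~ B) → Part F pos B

-- p ⊑ q : the occurrence p lies inside (or equals) the occurrence q.

data _⊑_ {F : Formula} : ∀ {s t B C} → Part F s B → Part F t C → Set where
  here : ∀ {s B} {p : Part F s B} → p ⊑ p
  inˡ  : ∀ {t B C D} {p : Part F pos (B ∨ C)} {q : Part F t D} → p ⊑ q → ∨ˡ p ⊑ q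
  inʳ  : ∀ {t B C D} {p : Part F pos (B ∨ C)} {q : Part F t D} → p ⊑ q → ∨ʳ p ⊑ q
  in⁺  : ∀ {t B D} {p : Part F pos (~ B)} {q : Part F t D} → p ⊑ q → ~⁺ p ⊑ q
  in⁻  : ∀ {t B D} {p : Part F neg (~ B)} {q : Part F t D} → p ⊑ q → ~⁻ p ⊑ q

NonOverlapping : ∀ {F s t B C} → Part F s B → Part F t C → Set
NonOverlapping p q = ¬ (p ⊑ q) × ¬ (q ⊑ p)

-- F is of the form F[B₊,B₋] for some B.

Clash : Formula → Set
Clash F = ∃[ B ] Σ[ p ∈ Part F pos B ] Σ[ q ∈ Part F neg B ] NonOverlapping p q

record Hintikka (H : Formula) : Set where
  field
    noClash : ¬ Clash H
    ∨-neg   : ∀ {B C} → Part H neg (B ∨ C) → Part H neg B ⊎ Part H neg C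
    closed₁ : ∀ {a b} → Part H neg (ε a b) → Part H neg (ε a a)
    closed₂ : ∀ {a b c} → Part H neg (ε a b) → Part H neg (ε b c) → Part H neg (ε a c)
    closed₃ : ∀ {a b} → Part H neg (ε a b) → Part H neg (ε b b) → Part H neg (ε b a)

-- Disjunctions of one or more literals, with arbitrary bracketing.

data LiteralDisjunction : Formula → Set where
  lit⁺ : ∀ a b → LiteralDisjunction (ε a b)
  lit⁻ : ∀ a b → LiteralDisjunction (~ ε a b)
  _∨ᵈ_ : ∀ {A B} → LiteralDisjunction A → LiteralDisjunction B → LiteralDisjunction (A ∨ B)

-- a₀ ⊣H A : A is rejected in HAR, where a₀ is the fixed name variable.

data _⊣H_ (a₀ : Name) : Formula → Set where
  rej⁺     : a₀ ⊣H ε a₀ a₀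
  rej⁻     : a₀ ⊣H ~ ε a₀ a₀
  rejMP    : ∀ {A B} → ⊢H A ⊃ B → a₀ ⊣H B → a₀ ⊣H A
  rejSub   : ∀ {B} (σ : Name → Name) → a₀ ⊣H rename σ B → a₀ ⊣H B
  rejExt   : ∀ {A} a b → Hintikka A → LiteralDisjunction A → a₀ ⊣H A →
             ¬ Part A neg (ε a b) → a₀ ⊣H A ∨ ε a b

{-# OPTIONS --safe #-}
-- Search the finitely many valuations supported on pairs of names of A.  If
-- none satisfies all instances (over these names) of the three axioms and
-- falsifies A, then A follows from these instances by a tautology.  Otherwise
-- let v be such a valuation: the disjunction H of all literals, over these
-- names, that are false under v is implied by A, so it suffices to reject H.
-- The negative literals of H are rejected by identifying all names with a₀
-- (if there are none, ε a₀ a₀ is used instead), and the positive ones are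
-- then added one by one.  Every intermediate disjunction is false under v, and
-- its negative parts are exactly the atoms true under v, so it is a Hintikka
-- formula.
module Submission where

open import Data.Bool.Base using (Bool; true; false; not) renaming (_∨_ to _or_)
open import Data.Bool.Properties using (¬-not; ∨-idem; ∨-zeroʳ) renaming (_≟_ to _≟ᵇ_)
open import Data.List.Base using (List; []; _∷_; _++_; map; foldr; filter; concatMap; cartesianProduct)
open import Data.List.Membership.Propositional using (_∈_; find; lose)
open import Data.List.Membership.Propositional.Properties using (∈-++⁺ˡ; ∈-++⁺ʳ; ∈-++⁻; ∈-map⁺; ∈-map⁻; ∈-filter⁺; ∈-filter⁻; ∈-cartesianProduct⁺; ∈-cartesianProduct⁻)
open import Data.List.Relation.Binary.Subset.Propositional using (_⊆_)
open import Data.List.Relation.Unary.All as All using (All; []; _∷_)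
import Data.List.Relation.Unary.All.Properties as All
open import Data.List.Relation.Unary.Any using (here; there; any?)
open import Data.Nat.Base using (ℕ; zero; suc; _+_)
open import Data.Nat.Properties using (_≟_; +-suc; suc-injective; +-identityʳ)
open import Data.Product.Base using (_×_; _,_; proj₁; proj₂; ∃-syntax)
open import Data.Product.Properties using (≡-dec)
open import Data.Sum.Base using (_⊎_; inj₁; inj₂)
open import Function.Base using (_∘_; id)
open import Relation.Binary.PropositionalEquality using (_≡_; refl; sym; trans; cong; cong₂; subst)
open import Relation.Nullary.Decidable using (does; yes; no; dec-true; dec-false)
open import Relation.Nullary.Negation.Core using (¬_; contradiction)
open import Data.List.Membership.DecPropositional (≡-dec _≟_ _≟_) using (_∈?_)
open import Defs

Atom : Set
Atom = Name × Name

Valuation : Set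
Valuation = Atom → Bool

-- Cantor's enumeration of pairs

nextPair : ℕ × ℕ → ℕ × ℕ
nextPair (a , zero)  = zero , suc a
nextPair (a , suc b) = suc a , b

decodePair : ℕ → ℕ × ℕ
decodePair zero    = zero , zero
decodePair (suc n) = nextPair (decodePair n)

-- `nextPair` walks down a diagonal and then jumps to the next one: `(suc a , b)` is reached from
-- `(a , suc b)`, and `(0 , suc b)` from `(b , 0)`. The explicit `s` makes the recursion
-- lexicographic in `s` and `a`.
decodePair-onDiagonal : ∀ s a b → a + b ≡ s → ∃[ n ] decodePair n ≡ (a , b)
decodePair-onDiagonal s (suc a) b eq
  with n , e ← decodePair-onDiagonal s a (suc b) (trans (+-suc a b) eq) = suc n , cong nextPair e
decodePair-onDiagonal s zero zero eq = zero , refl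
decodePair-onDiagonal (suc s) zero (suc b) eq
  with n , e ← decodePair-onDiagonal s b zero (trans (+-identityʳ b) (suc-injective eq)) = suc n , cong nextPair e

encodePair : ℕ × ℕ → ℕ
encodePair (a , b) = proj₁ (decodePair-onDiagonal (a + b) a b refl)

decode-encode : ∀ x → decodePair (encodePair x) ≡ x
decode-encode (a , b) = proj₂ (decodePair-onDiagonal (a + b) a b refl)

⟪encode⟫⟪decode⟫ : ∀ F → (F ⟪ atom ∘ encodePair ⟫) ⟪ atom ∘ decodePair ⟫ ≡ F
⟪encode⟫⟪decode⟫ (atom x) = cong atom (decode-encode x)
⟪encode⟫⟪decode⟫ (~ F)    = cong ~_ (⟪encode⟫⟪decode⟫ F)
⟪encode⟫⟪decode⟫ (F ∨ G)  = cong₂ _∨_ (⟪encode⟫⟪decode⟫ F) (⟪encode⟫⟪decode⟫ G)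

eval-⟪atom⟫ : ∀ {X Y} (f : X → Y) v F → eval v (F ⟪ atom ∘ f ⟫) ≡ eval (v ∘ f) F
eval-⟪atom⟫ f v (atom x) = refl
eval-⟪atom⟫ f v (~ F)    = cong not (eval-⟪atom⟫ f v F)
eval-⟪atom⟫ f v (F ∨ G)  = cong₂ _or_ (eval-⟪atom⟫ f v F) (eval-⟪atom⟫ f v G)

-- The schemata in `taut` have atoms in `ℕ`, so the atoms of `F` are coded as numbers and the
-- substitution decodes them again.
tautology⇒⊢H : ∀ F → Tautology F → ⊢H F
tautology⇒⊢H F t = subst ⊢H_ (⟪encode⟫⟪decode⟫ F)
  (taut (F ⟪ atom ∘ encodePair ⟫)
        (λ v → trans (eval-⟪atom⟫ encodePair v F) (t (v ∘ encodePair)))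
        (atom ∘ decodePair))

-- Valuations

module _ (v : Valuation) where

  eval-⊃-elim : ∀ A B → eval v (A ⊃ B) ≡ true → eval v A ≡ true → eval v B ≡ true
  eval-⊃-elim A B h a rewrite a = h

  eval-∧-intro : ∀ A B → eval v A ≡ true → eval v B ≡ true → eval v (A ∧ B) ≡ true
  eval-∧-intro A B a b rewrite a | b = refl

  eval-⊃-intro : ∀ A B → (eval v B ≡ false → eval v A ≡ false) → eval v (A ⊃ B) ≡ true
  eval-⊃-intro A B h with eval v B
  ... | true  = ∨-zeroʳ _
  ... | false rewrite h refl = refl

  eval-∨-false : ∀ A B → eval v (A ∨ B) ≡ false → eval v A ≡ false × eval v B ≡ false
  eval-∨-false A B h with eval v A
  ... | false = refl , h

  eval-~-false : ∀ A → eval v (~ A) ≡ false → eval v A ≡ true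
  eval-~-false A h with eval v A
  ... | true = refl

  eval-~-true : ∀ A → eval v (~ A) ≡ true → eval v A ≡ false
  eval-~-true A h with eval v A
  ... | false = refl

-- Finite search for a countermodel

AllAtoms : (Atom → Set) → Formula → Set
AllAtoms P (atom x) = P x
AllAtoms P (~ F)    = AllAtoms P F
AllAtoms P (F ∨ G)  = AllAtoms P F × AllAtoms P G

eval-cong : ∀ {P : Atom → Set} {v w : Valuation} → (∀ {x} → P x → v x ≡ w x) →
            ∀ F → AllAtoms P F → eval v F ≡ eval w F
eval-cong h (atom x) p       = h p
eval-cong h (~ F)    p       = cong not (eval-cong h F p)
eval-cong h (F ∨ G)  (p , q) = cong₂ _or_ (eval-cong h F p) (eval-cong h G q)

-- A valuation of finite support is given by the list of its true atoms, so that a search over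
-- `sublists L` is finite.
char : List Atom → Valuation
char S x = does (x ∈? S)

char⁺ : ∀ {S x} → x ∈ S → char S x ≡ true
char⁺ {S} {x} = dec-true (x ∈? S)

char⁻ : ∀ {S x} → char S x ≡ true → x ∈ S
char⁻ {S} {x} h with x ∈? S
... | yes x∈S = x∈S

char-filter : ∀ (w : Valuation) {L x} → x ∈ L → char (filter (λ y → w y ≟ᵇ true) L) x ≡ w x
char-filter w {L} {x} x∈L with w x in eq
... | true  = char⁺ (∈-filter⁺ (λ y → w y ≟ᵇ true) x∈L eq)
... | false = dec-false (x ∈? _) λ x∈F →
  contradiction (trans (sym (proj₂ (∈-filter⁻ (λ y → w y ≟ᵇ true) {xs = L} x∈F))) eq) λ ()

sublists : ∀ {X : Set} → List X → List (List X)
sublists []       = [] ∷ []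
sublists (x ∷ xs) = map (x ∷_) (sublists xs) ++ sublists xs

∈-sublists⇒⊆ : ∀ {X : Set} (L : List X) {S} → S ∈ sublists L → S ⊆ L
∈-sublists⇒⊆ []       (here refl) ()
∈-sublists⇒⊆ (x ∷ xs) S∈ y∈S with ∈-++⁻ (map (x ∷_) (sublists xs)) S∈
... | inj₂ S∈xs = there (∈-sublists⇒⊆ xs S∈xs y∈S)
... | inj₁ S∈map with ∈-map⁻ (x ∷_) S∈map | y∈S
...   | _ , _    , refl | here refl  = here refl
...   | _ , T∈xs , refl | there y∈T = there (∈-sublists⇒⊆ xs T∈xs y∈T)

filter∈sublists : ∀ (w : Valuation) L → filter (λ y → w y ≟ᵇ true) L ∈ sublists L
filter∈sublists w []       = here refl
filter∈sublists w (x ∷ xs) with w x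
... | true  = ∈-++⁺ˡ (∈-map⁺ (x ∷_) (filter∈sublists w xs))
... | false = ∈-++⁺ʳ (map (x ∷_) (sublists xs)) (filter∈sublists w xs)

-- The value of `F` depends only on the atoms in `L`, and there every valuation agrees with `char S`
-- for some sublist `S` of `L`.
tautology-or-countermodel : ∀ L F → AllAtoms (_∈ L) F →
                            Tautology F ⊎ (∃[ S ] S ⊆ L × eval (char S) F ≡ false)
tautology-or-countermodel L F F⊆L with any? (λ S → eval (char S) F ≟ᵇ false) (sublists L)
... | yes a with S , S∈ , e ← find a = inj₂ (S , ∈-sublists⇒⊆ L S∈ , e)
... | no ¬a = inj₁ λ w → ¬-not λ e →
  ¬a (lose (filter∈sublists w L) (trans (eval-cong (char-filter w) F F⊆L) e))

-- Axiom instances over a finite list of names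

axiomsAt : Name × Name × Name → List Formula
axiomsAt (a , b , c) =
  (ε a b ⊃ ε a a) ∷ ((ε a b ∧ ε b c) ⊃ ε a c) ∷ ((ε a b ∧ ε b b) ⊃ ε b a) ∷ []

axioms : List Name → List Formula
axioms N = concatMap axiomsAt (cartesianProduct N (cartesianProduct N N))

module _ {P : Formula → Set} {N : List Name} where

  All-axioms⁺ : (∀ {a b c} → a ∈ N → b ∈ N → c ∈ N → All P (axiomsAt (a , b , c))) → All P (axioms N)
  All-axioms⁺ h = All.concat⁺ (All.map⁺ (All.tabulate λ t∈ →
    let a∈ , bc∈ = ∈-cartesianProduct⁻ N (cartesianProduct N N) t∈
        b∈ , c∈  = ∈-cartesianProduct⁻ N N bc∈
    in h a∈ b∈ c∈))

  All-axioms⁻ : All P (axioms N) → ∀ {a b c} → a ∈ N → b ∈ N → c ∈ N → All P (axiomsAt (a , b , c))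
  All-axioms⁻ h a∈ b∈ c∈ = All.lookup (All.map⁻ (All.concat⁻ h))
    (∈-cartesianProduct⁺ a∈ (∈-cartesianProduct⁺ b∈ c∈))

⊢H-axioms : ∀ N → All ⊢H_ (axioms N)
⊢H-axioms N = All-axioms⁺ {N = N} λ {a} {b} {c} _ _ _ → ax₁ a b ∷ ax₂ a b c ∷ ax₃ a b ∷ []

-- The hypotheses are curried so that they can be discharged by modus ponens one at a time.
_⊃*_ : List Formula → Formula → Formula
Γ ⊃* A = foldr _⊃_ A Γ

mp* : ∀ {Γ A} → All ⊢H_ Γ → ⊢H (Γ ⊃* A) → ⊢H A
mp* []       d = d
mp* (e ∷ es) d = mp* es (mp d e)

eval-⊃*-false : ∀ v Γ A → eval v (Γ ⊃* A) ≡ false → All (λ B → eval v B ≡ true) Γ × eval v A ≡ false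
eval-⊃*-false v []      A h = [] , h
eval-⊃*-false v (B ∷ Γ) A h
  with b , h′ ← eval-∨-false v (~ B) (Γ ⊃* A) h
  with bs , a ← eval-⊃*-false v Γ A h′ = eval-~-false v B b ∷ bs , a

AllAtoms-⊃* : ∀ {P Γ A} → All (AllAtoms P) Γ → AllAtoms P A → AllAtoms P (Γ ⊃* A)
AllAtoms-⊃* []       a = a
AllAtoms-⊃* (b ∷ bs) a = b , AllAtoms-⊃* bs a

AllAtoms-axioms : ∀ N → All (AllAtoms (_∈ cartesianProduct N N)) (axioms N)
AllAtoms-axioms N = All-axioms⁺ {N = N} λ a b c →
  (a ⊗ b , a ⊗ a) ∷ ((a ⊗ b , b ⊗ c) , a ⊗ c) ∷ ((a ⊗ b , b ⊗ b) , b ⊗ a) ∷ []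
  where
  _⊗_ : ∀ {a b} → a ∈ N → b ∈ N → (a , b) ∈ cartesianProduct N N
  _⊗_ = ∈-cartesianProduct⁺

names : Formula → List Name
names (ε a b) = a ∷ b ∷ []
names (~ F)   = names F
names (F ∨ G) = names F ++ names G

AllAtoms-names : ∀ {N} F → names F ⊆ N → AllAtoms (_∈ cartesianProduct N N) F
AllAtoms-names (ε a b) h = ∈-cartesianProduct⁺ (h (here refl)) (h (there (here refl)))
AllAtoms-names (~ F)   h = AllAtoms-names F h
AllAtoms-names (F ∨ G) h = AllAtoms-names F (h ∘ ∈-++⁺ˡ) , AllAtoms-names G (h ∘ ∈-++⁺ʳ (names F))

-- Valuations closed under the axioms

record Closed (v : Valuation) : Set where
  field
    closed₁ : ∀ {a b} → v (a , b) ≡ true → v (a , a) ≡ true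
    closed₂ : ∀ {a b c} → v (a , b) ≡ true → v (b , c) ≡ true → v (a , c) ≡ true
    closed₃ : ∀ {a b} → v (a , b) ≡ true → v (b , b) ≡ true → v (b , a) ≡ true

-- Closure concerns all names, but `supp` puts the names of every true atom into `N`, where the
-- instances are known to hold.
axioms⇒Closed : ∀ {N v} → (∀ {a b} → v (a , b) ≡ true → a ∈ N × b ∈ N) →
                All (λ B → eval v B ≡ true) (axioms N) → Closed v
axioms⇒Closed {N} {v} supp h = record { closed₁ = c₁ ; closed₂ = c₂ ; closed₃ = c₃ }
  where
  instances : ∀ {a b c} → a ∈ N → b ∈ N → c ∈ N → All (λ B → eval v B ≡ true) (axiomsAt (a , b , c))
  instances = All-axioms⁻ h

  c₁ : ∀ {a b} → v (a , b) ≡ true → v (a , a) ≡ true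
  -- `axiomsAt` takes triples while `ax₁` has two names; `b` fills the third place.
  c₁ {a} {b} ab with a∈ , b∈ ← supp ab with e ∷ _ ← instances a∈ b∈ b∈ =
    eval-⊃-elim v (ε a b) (ε a a) e ab

  c₂ : ∀ {a b c} → v (a , b) ≡ true → v (b , c) ≡ true → v (a , c) ≡ true
  c₂ {a} {b} {c} ab bc
    with a∈ , b∈ ← supp ab | _ , c∈ ← supp bc with _ ∷ e ∷ _ ← instances a∈ b∈ c∈ =
    eval-⊃-elim v (ε a b ∧ ε b c) (ε a c) e (eval-∧-intro v (ε a b) (ε b c) ab bc)

  c₃ : ∀ {a b} → v (a , b) ≡ true → v (b , b) ≡ true → v (b , a) ≡ true
  c₃ {a} {b} ab bb with a∈ , b∈ ← supp ab with _ ∷ _ ∷ e ∷ _ ← instances a∈ b∈ b∈ =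
    eval-⊃-elim v (ε a b ∧ ε b b) (ε b a) e (eval-∧-intro v (ε a b) (ε b b) ab bb)

-- Parts of false formulas and of literal disjunctions

falsifier : Sign → Bool
falsifier pos = false
falsifier neg = true

-- Both disjuncts of a false disjunction are false, and negation flips value and sign together.
-- Negative disjunctions are never split by `Part`.
eval-part : ∀ v {F s B} → eval v F ≡ false → Part F s B → eval v B ≡ falsifier s
eval-part v h whole            = h
eval-part v h (∨ˡ {B} {C} p)   = proj₁ (eval-∨-false v B C (eval-part v h p))
eval-part v h (∨ʳ {B} {C} p)   = proj₂ (eval-∨-false v B C (eval-part v h p))
eval-part v h (~⁺ {B} p)       = eval-~-false v B (eval-part v h p)
eval-part v h (~⁻ {B} p)       = eval-~-true v B (eval-part v h p)

false⇒noClash : ∀ v {F} → eval v F ≡ false → ¬ Clash F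
false⇒noClash v h (_ , p , q , _) = contradiction (trans (sym (eval-part v h p)) (eval-part v h q)) λ ()

-- The invariant along a path: negation occurs only directly above an atom, so a negative part
-- cannot be decomposed further.
LiteralDisjunctionPart : Sign → Formula → Set
LiteralDisjunctionPart pos B = LiteralDisjunction B
LiteralDisjunctionPart neg B = ∃[ x ] B ≡ atom x

literalDisjunctionPart : ∀ {F s B} → LiteralDisjunction F → Part F s B → LiteralDisjunctionPart s B
literalDisjunctionPart l whole = l
literalDisjunctionPart l (∨ˡ p) with b ∨ᵈ _ ← literalDisjunctionPart l p = b
literalDisjunctionPart l (∨ʳ p) with _ ∨ᵈ c ← literalDisjunctionPart l p = c
literalDisjunctionPart l (~⁺ p) with lit⁻ a b ← literalDisjunctionPart l p = (a , b) , refl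
literalDisjunctionPart l (~⁻ p) with () ← proj₂ (literalDisjunctionPart l p)

-- Paths start at the root, so only the base case `whole` gains a step.
part-∨ˡ : ∀ {F G s B} → Part F s B → Part (F ∨ G) s B
part-∨ˡ whole  = ∨ˡ whole
part-∨ˡ (∨ˡ p) = ∨ˡ (part-∨ˡ p)
part-∨ˡ (∨ʳ p) = ∨ʳ (part-∨ˡ p)
part-∨ˡ (~⁺ p) = ~⁺ (part-∨ˡ p)
part-∨ˡ (~⁻ p) = ~⁻ (part-∨ˡ p)

part-∨ʳ : ∀ {F G s B} → Part G s B → Part (F ∨ G) s B
part-∨ʳ whole  = ∨ʳ whole
part-∨ʳ (∨ˡ p) = ∨ˡ (part-∨ʳ p)
part-∨ʳ (∨ʳ p) = ∨ʳ (part-∨ʳ p)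
part-∨ʳ (~⁺ p) = ~⁺ (part-∨ʳ p)
part-∨ʳ (~⁻ p) = ~⁻ (part-∨ʳ p)

-- Rejected disjunctions of false literals

-- The invariant of the construction. By `false-at` negative parts are true, so with `negative` the
-- negative atoms are exactly those true under `v`.
record RejectedBy (a₀ : Name) (v : Valuation) (D : Formula) : Set where
  field
    literals : LiteralDisjunction D
    false-at : eval v D ≡ false
    negative : ∀ {x} → v x ≡ true → Part D neg (atom x)
    rejected : a₀ ⊣H D

open RejectedBy

-- The closure conditions on negative parts translate into those on `v`; the condition on
-- disjunctions is vacuous, since negative parts are atoms.
rejectedBy⇒Hintikka : ∀ {a₀ v D} → Closed v → RejectedBy a₀ v D → Hintikka D
rejectedBy⇒Hintikka {v = v} {D} cl r = record
  { noClash = false⇒noClash v (false-at r)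
  ; ∨-neg   = λ p → contradiction (proj₂ (literalDisjunctionPart (literals r) p)) λ ()
  ; closed₁ = λ p → negative r (closed₁ (holds p))
  ; closed₂ = λ p q → negative r (closed₂ (holds p) (holds q))
  ; closed₃ = λ p q → negative r (closed₃ (holds p) (holds q))
  }
  where
  open Closed cl
  holds : ∀ {B} → Part D neg B → eval v B ≡ true
  holds = eval-part v (false-at r)

rejectedBy-∨ : ∀ {a₀ v D} → Closed v → ∀ {x} → v x ≡ false → RejectedBy a₀ v D → RejectedBy a₀ v (D ∨ atom x)
rejectedBy-∨ {v = v} cl {a , b} vx r = record
  { literals = literals r ∨ᵈ lit⁺ a b
  ; false-at = trans (cong (_or v (a , b)) (false-at r)) vx
  ; negative = part-∨ˡ ∘ negative r
  ; rejected = rejExt a b (rejectedBy⇒Hintikka cl r) (literals r) (rejected r)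
      -- Negative parts of `D` are true under `v`, but the new atom is false.
      λ p → contradiction (trans (sym vx) (eval-part v (false-at r) p)) λ ()
  }

rejectedBy-extend : ∀ {a₀ v D} → Closed v → RejectedBy a₀ v D → ∀ xs → All (λ x → v x ≡ false) xs →
                    ∃[ E ] RejectedBy a₀ v E × All (λ x → Part E pos (atom x)) xs
rejectedBy-extend cl r [] [] = _ , r , []
rejectedBy-extend cl r (x ∷ xs) (vx ∷ vxs)
  with E , rE , ps ← rejectedBy-extend cl r xs vxs =
  E ∨ atom x , rejectedBy-∨ cl vx rE , ∨ʳ whole ∷ All.map part-∨ˡ ps

-- The head is a separate argument because there is no empty disjunction.
negations : Atom → List Atom → Formula
negations x []       = ~ atom x
negations x (y ∷ ys) = ~ atom x ∨ negations y ys

negations-literals : ∀ x xs → LiteralDisjunction (negations x xs)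
negations-literals (a , b) []       = lit⁻ a b
negations-literals (a , b) (y ∷ ys) = lit⁻ a b ∨ᵈ negations-literals y ys

eval-negations : ∀ v x xs → All (λ y → v y ≡ true) (x ∷ xs) → eval v (negations x xs) ≡ false
eval-negations v x []       (e ∷ []) = cong not e
eval-negations v x (y ∷ ys) (e ∷ es) = cong₂ _or_ (cong not e) (eval-negations v y ys es)

negations-negative : ∀ x xs {y} → y ∈ x ∷ xs → Part (negations x xs) neg (atom y)
negations-negative x []       (here refl) = ~⁺ whole
negations-negative x (z ∷ zs) (here refl) = ~⁺ (∨ˡ whole)
negations-negative x (z ∷ zs) (there y∈)  = part-∨ʳ (negations-negative z zs y∈)

eval-rename-negations : ∀ a₀ v x xs → eval v (rename (λ _ → a₀) (negations x xs)) ≡ not (v (a₀ , a₀))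
eval-rename-negations a₀ v x []       = refl
eval-rename-negations a₀ v x (y ∷ ys) =
  trans (cong (not (v (a₀ , a₀)) or_) (eval-rename-negations a₀ v y ys)) (∨-idem _)

-- Once all names are `a₀`, every disjunct is `~ ε a₀ a₀`, so the disjunction implies this rejected
-- formula.
negations-rejected : ∀ a₀ x xs → a₀ ⊣H negations x xs
negations-rejected a₀ x xs = rejSub (λ _ → a₀) (rejMP (tautology⇒⊢H (D ⊃ ~ ε a₀ a₀) D⊃~) rej⁻)
  where
  D : Formula
  D = rename (λ _ → a₀) (negations x xs)
  D⊃~ : Tautology (D ⊃ ~ ε a₀ a₀)
  D⊃~ v = eval-⊃-intro v D (~ ε a₀ a₀) (trans (eval-rename-negations a₀ v x xs))

rejectedBy-base : ∀ a₀ S → ∃[ D ] RejectedBy a₀ (char S) D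
rejectedBy-base a₀ [] = ε a₀ a₀ , record
  { literals = lit⁺ a₀ a₀
  ; false-at = refl
  ; negative = λ ()
  ; rejected = rej⁺
  }
rejectedBy-base a₀ (x ∷ xs) = negations x xs , record
  { literals = negations-literals x xs
  ; false-at = eval-negations (char (x ∷ xs)) x xs (All.tabulate char⁺)
  ; negative = λ e → negations-negative x xs (char⁻ e)
  ; rejected = negations-rejected a₀ x xs
  }

-- From countermodels to rejection

countermodel⇒⊣H : ∀ a₀ {S L} A → AllAtoms (_∈ L) A → Closed (char S) → eval (char S) A ≡ false → a₀ ⊣H A
countermodel⇒⊣H a₀ {S} {L} A A⊆L cl vA
  with D , rD ← rejectedBy-base a₀ S
  with E , rE , ps ← rejectedBy-extend cl rD (filter (λ x → char S x ≟ᵇ false) L) (All.all-filter _ L) =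
  -- `E` has every true atom as a negative part and every false atom of `L` as a positive part.
  -- Hence any `w` falsifying `E` agrees with `char S` on `L` and falsifies `A`.
  rejMP (tautology⇒⊢H (A ⊃ E) λ w → eval-⊃-intro w A E λ wE →
           trans (eval-cong (agree w wE) A A⊆L) vA)
        (rejected rE)
  where
  agree : ∀ w → eval w E ≡ false → ∀ {x} → x ∈ L → w x ≡ char S x
  agree w wE {x} x∈L with char S x in eq
  ... | true  = eval-part w wE (negative rE eq)
  ... | false = eval-part w wE (All.lookup ps (∈-filter⁺ (λ y → char S y ≟ᵇ false) x∈L eq))

⊢H-or-⊣H : ∀ a₀ A → (⊢H A) ⊎ (a₀ ⊣H A)
⊢H-or-⊣H a₀ A
  with tautology-or-countermodel (cartesianProduct (names A) (names A)) (axioms (names A) ⊃* A)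
         (AllAtoms-⊃* (AllAtoms-axioms (names A)) (AllAtoms-names A id))
... | inj₁ t = inj₁ (mp* (⊢H-axioms (names A)) (tautology⇒⊢H _ t))
... | inj₂ (S , S⊆L , e) with axs , vA ← eval-⊃*-false (char S) (axioms (names A)) A e =
  inj₂ (countermodel⇒⊣H a₀ {S} A (AllAtoms-names A id) (axioms⇒Closed supp axs) vA)
  where
  -- The search covers only sublists of `L`, so true atoms use only names of `A`.
  supp : ∀ {a b} → char S (a , b) ≡ true → a ∈ names A × b ∈ names A
  supp h = ∈-cartesianProduct⁻ (names A) (names A) (S⊆L (char⁻ h))

theorem3p2 : (a₀ : Name) (A : Formula) → (¬ (⊢H A) → a₀ ⊣H A) × ((⊢H A) ⊎ (a₀ ⊣H A))
theorem3p2 a₀ A with ⊢H-or-⊣H a₀ A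
... | inj₁ d = (λ ¬d → contradiction d ¬d) , inj₁ d
... | inj₂ r = (λ _ → r) , inj₂ r
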